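{- As formal power series in $q$ (equivalently, for complex $q$ with $|q|<1$), $$\sum_{n\ge 0}\frac{q^{2n^2-n}}{(q;q)_{2n}}=\frac{1}{(q;q)_\infty}\sum_{k\in\mathbb{Z}}(-1)^kq^{3k^2-k}=\frac{(q^2;q^2)_\infty}{(q;q)_\infty}=(-q;q)_\infty .$$
   Context: $(z;q)_n=\prod_{j=0}^{n-1}(1-q^jz)$ and $(z;q)_\infty=\prod_{j\ge0}(1-q^jz)$; thus $(q;q)_\infty=\prod_{j\ge1}(1-q^j)$, $(q^2;q^2)_\infty=\prod_{j\ge1}(1-q^{2j})$, $(-q;q)_\infty=\prod_{j\ge1}(1+q^j)$. -}

module Defs where

open import Data.Nat.Base as ℕ using (ℕ; zero; suc; z≤n; s≤s)
import Data.Nat.Properties as ℕP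
open import Data.Integer.Base as ℤ using (ℤ; +_; -[1+_]; 0ℤ; 1ℤ; ∣_∣)
import Data.Integer.Properties as ℤP
open import Data.Fin.Base as Fin using (Fin; toℕ)
open import Data.Product.Base using (∃; _,_)
open import Data.Vec.Functional using (Vector; _∷_; head)
open import Algebra.Properties.CommutativeMonoid.Sum ℤP.+-0-commutativeMonoid
open import Relation.Binary.PropositionalEquality

-- Formal power series with integer coefficients; `f n` is the coefficient
-- of the n-th power of the indeterminate.  Series are compared with _≗_.
FPS : Set
FPS = ℕ → ℤ

infixl 6 _+_ _-_
infixl 7 _*_ _/_
infix  8 -_
infixr 9 _^_

0# : FPS
0# _ = 0ℤ

1# : FPS
1# zero    = 1ℤ
1# (suc _) = 0ℤ

q : FPS
q zero          = 0ℤ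
q (suc zero)    = 1ℤ
q (suc (suc _)) = 0ℤ

_+_ : FPS → FPS → FPS
(f + g) n = f n ℤ.+ g n

-_ : FPS → FPS
(- f) n = ℤ.- f n

_-_ : FPS → FPS → FPS
f - g = f + - g

_*_ : FPS → FPS → FPS
(f * g) n = ∑[ i ≤ n ] (f (toℕ i) ℤ.* g (n ℕ.∸ toℕ i))

_^_ : FPS → ℕ → FPS
f ^ zero  = 1#
f ^ suc n = f * f ^ n

-- The coefficients of 1/f in degrees n, n-1, …, 0 (in this order), solved
-- from f * (1/f) = 1.  A series over ℤ is invertible iff its constant term c
-- is ±1, and then 1/c = c.  For other f the value is meaningless.
invCoeffs : FPS → (n : ℕ) → Vector ℤ (suc n)
invCoeffs f zero    = λ _ → f 0
invCoeffs f (suc n) =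
  (ℤ.- (f 0 ℤ.* ∑[ i ≤ n ] (f (suc (toℕ i)) ℤ.* invCoeffs f n i)))
  ∷ invCoeffs f n

inv : FPS → FPS
inv f n = head (invCoeffs f n)

_/_ : FPS → FPS → FPS
f / g = f * inv g

invCoeffs-inv : ∀ f n (i : Fin (suc n)) → invCoeffs f n i ≡ inv f (n ℕ.∸ toℕ i)
invCoeffs-inv f zero    Fin.zero    = refl
invCoeffs-inv f (suc n) Fin.zero    = refl
invCoeffs-inv f (suc n) (Fin.suc i) = invCoeffs-inv f n i

*-inv : ∀ f → f 0 ℤ.* f 0 ≡ 1ℤ → f * inv f ≗ 1#
*-inv f u zero    = trans (ℤP.+-identityʳ _) u
*-inv f u (suc n) = begin
  f 0 ℤ.* (ℤ.- (f 0 ℤ.* s)) ℤ.+ ∑[ i ≤ n ] (f (suc (toℕ i)) ℤ.* inv f (n ℕ.∸ toℕ i))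
    ≡⟨ cong₂ ℤ._+_ lhs (sum-cong-≗ λ i →
         cong (f (suc (toℕ i)) ℤ.*_) (sym (invCoeffs-inv f n i))) ⟩
  ℤ.- s ℤ.+ s
    ≡⟨ ℤP.+-inverseˡ s ⟩
  0ℤ ∎
  where
  open ≡-Reasoning
  s = ∑[ i ≤ n ] (f (suc (toℕ i)) ℤ.* invCoeffs f n i)
  lhs : f 0 ℤ.* (ℤ.- (f 0 ℤ.* s)) ≡ ℤ.- s
  lhs = begin
    f 0 ℤ.* (ℤ.- (f 0 ℤ.* s)) ≡⟨ ℤP.neg-distribʳ-* (f 0) (f 0 ℤ.* s) ⟨
    ℤ.- (f 0 ℤ.* (f 0 ℤ.* s)) ≡⟨ cong ℤ.-_ (ℤP.*-assoc (f 0) (f 0) s) ⟨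
    ℤ.- (f 0 ℤ.* f 0 ℤ.* s)   ≡⟨ cong (λ c → ℤ.- (c ℤ.* s)) u ⟩
    ℤ.- (1ℤ ℤ.* s)            ≡⟨ cong ℤ.-_ (ℤP.*-identityˡ s) ⟩
    ℤ.- s ∎

-- Convergence in ℤ[[q]]: every coefficient is eventually constant.
_⟶_ : (ℕ → FPS) → FPS → Set
s ⟶ L = ∀ m → ∃ λ N → ∀ n → N ℕ.≤ n → s n m ≡ L m

⟶-unique : ∀ {s L L′} → s ⟶ L → s ⟶ L′ → L ≗ L′
⟶-unique c c′ m with c m | c′ m
... | N , p | N′ , p′ = trans (sym (p (N ℕ.⊔ N′) (ℕP.m≤m⊔n N N′)))
                              (p′ (N ℕ.⊔ N′) (ℕP.m≤n⊔m N N′))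

partialSum : (ℕ → FPS) → ℕ → FPS
partialSum f zero    = 0#
partialSum f (suc n) = partialSum f n + f n

∑ℕ_≈_ : (ℕ → FPS) → FPS → Set
∑ℕ f ≈ S = partialSum f ⟶ S

-- Σ f k over -a ≤ k < b.
partialSumℤ : (ℤ → FPS) → ℕ → ℕ → FPS
partialSumℤ f a b =
  partialSum (λ n → f -[1+ n ]) a + partialSum (λ n → f (+ n)) b

-- The two ends of the range tend to infinity independently.
∑ℤ_≈_ : (ℤ → FPS) → FPS → Set
∑ℤ f ≈ S = ∀ m → ∃ λ N → ∀ a b → N ℕ.≤ a → N ℕ.≤ b → partialSumℤ f a b m ≡ S m

∑ℤ-unique : ∀ {f S S′} → ∑ℤ f ≈ S → ∑ℤ f ≈ S′ → S ≗ S′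
∑ℤ-unique c c′ m with c m | c′ m
... | N , p | N′ , p′ = trans (sym (p M M l l)) (p′ M M l′ l′)
  where
  M  = N ℕ.⊔ N′
  l  = ℕP.m≤m⊔n N N′
  l′ = ℕP.m≤n⊔m N N′

-- ⟨ z ⨾ b ⟩ n is the q-Pochhammer symbol (z;b)ₙ, with base b.
⟨_⨾_⟩_ : FPS → FPS → ℕ → FPS
⟨ z ⨾ b ⟩ zero  = 1#
⟨ z ⨾ b ⟩ suc n = ⟨ z ⨾ b ⟩ n * (1# - b ^ n * z)

-- (z;b)_∞ = P
⟨_⨾_⟩∞≈_ : FPS → FPS → FPS → Set
⟨ z ⨾ b ⟩∞≈ P = (⟨ z ⨾ b ⟩_) ⟶ P

-- Hence 1/(q;q)ₙ and 1/(q;q)_∞ are genuine inverses, by *-inv.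
⟨q⨾q⟩-const : ∀ n → (⟨ q ⨾ q ⟩ n) 0 ≡ 1ℤ
⟨q⨾q⟩-const zero    = refl
⟨q⨾q⟩-const (suc n)
  rewrite ⟨q⨾q⟩-const n | ℤP.*-zeroʳ ((q ^ n) 0) = refl

⟨q⨾q⟩∞-const : ∀ {P} → ⟨ q ⨾ q ⟩∞≈ P → P 0 ≡ 1ℤ
⟨q⨾q⟩∞-const c with c 0
... | N , p = trans (sym (p N ℕP.≤-refl)) (⟨q⨾q⟩-const N)

-- The truncated subtraction never truncates.
2n²-n : ℕ → ℕ
2n²-n n = 2 ℕ.* n ℕ.^ 2 ℕ.∸ n

2n²-n-exact : ∀ n → 2n²-n n ℕ.+ n ≡ 2 ℕ.* n ℕ.^ 2
2n²-n-exact n = ℕP.m∸n+n≡m (ℕP.≤-trans (n≤n² n) (ℕP.m≤m+n (n ℕ.^ 2) _))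
  where
  n≤n² : ∀ n → n ℕ.≤ n ℕ.^ 2
  n≤n² zero    = z≤n
  n≤n² (suc n) = ℕP.m≤m*n (suc n) (suc n ℕ.* 1)

-- The absolute value only converts to ℕ.
3k²-k : ℤ → ℕ
3k²-k k = ∣ + 3 ℤ.* k ℤ.^ 2 ℤ.- k ∣

3k²-k-exact : ∀ k → + 3k²-k k ≡ + 3 ℤ.* k ℤ.^ 2 ℤ.- k
3k²-k-exact k = ℤP.0≤i⇒+∣i∣≡i (ℤP.i≤j⇒0≤j-i (k≤3k² k))
  where
  k≤3k² : ∀ k → k ℤ.≤ + 3 ℤ.* k ℤ.^ 2
  k≤3k² (+ zero)  = ℤ.+≤+ z≤n
  k≤3k² (+ suc n) =
    ℤ.+≤+ (ℕP.≤-trans (ℕP.m≤m*n (suc n) (suc n ℕ.* 1)) (ℕP.m≤m+n _ _))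
  k≤3k² -[1+ n ]  = ℤ.-≤+

{-# OPTIONS --safe #-}
module Submission where

-- Put aₘ = q^(m(m+1)/2)/(q;q)ₘ.  Since 1/(q;q)ₘ = (1 - q^(m+1))/(q;q)ₘ₊₁, the
-- 2n-th term of Σ q^(m(m-1)/2)/(q;q)ₘ is a₂ₙ₋₁ + a₂ₙ, so the left-hand side is
-- Σ aₘ, which is (-q;q)_∞ by Euler: G(x) = Σ aₘxᵐ satisfies
-- G(x) = (1 + qx) G(qx), and iterating this gives G(1) = (-q;q)ⱼ G(qʲ) with
-- G(qʲ) → 1.  The theta series is the pentagonal number theorem in base q²,
-- for which Shanks' finite identity
--   Σ_{-n ≤ k ≤ n} (-1)ᵏ b^(k(3k-1)/2) = Σ_{0 ≤ k ≤ n} (-1)ᵏ (b;b)ₙ/(b;b)ₖ b^(nk + k(k+1)/2)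
-- exhibits (b;b)ₙ as the k = 0 term and all the others as multiples of bⁿ.

open import Algebra.Bundles using (CommutativeRing)
import Algebra.Solver.Ring.NaturalCoefficients.Default as SemiringSolver
import Algebra.Properties.Semiring.Exp as Exp
open import Data.Nat.Base as ℕ using (ℕ; zero; suc)
import Data.Nat.Properties as ℕP
open import Data.Product.Base using (∃-syntax; _×_; _,_)
open import Level using (0ℓ)
import Relation.Binary.Reasoning.Setoid as SetoidReasoning

-- Triangular and pentagonal exponents.

tri : ℕ → ℕ
tri zero    = 0
tri (suc n) = tri n ℕ.+ suc n

-- A separate recursion rather than `2 ℕ.* n`: `double (suc n)` reduces to two successors, so sums
-- up to it unfold by two terms at once.
double : ℕ → ℕ
double zero    = 0
double (suc n) = suc (suc (double n))

-- The pentagonal numbers k(3k - 1)/2 for k = n and k = -(n + 1).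
pent⁺ pent⁻ : ℕ → ℕ
pent⁺ zero    = 0
pent⁺ (suc n) = tri n ℕ.+ suc n ℕ.* suc n
pent⁻ n = tri (suc n) ℕ.+ suc n ℕ.* suc n

-- Congruences and finite products in an arbitrary commutative ring.

module QSeries (R : CommutativeRing 0ℓ 0ℓ) where
  open CommutativeRing R
  open Exp semiring
  open SemiringSolver commutativeSemiring
    using (solve; _:=_; _:+_; _:*_; con)
  open import Algebra.Properties.CommutativeSemigroup *-commutativeSemigroup using (x∙yz≈y∙xz)
  open import Algebra.Properties.Ring ring using (+-cancelʳ; -‿distribʳ-*; -‿involutive)
  open SetoidReasoning setoid

  infix 4 _≡_mod_
  -- Membership of x - y in the ideal of m, with the quotient as data. Truncation errors are
  -- recorded this way, so that convergence enters only once m is a power of `q`.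
  _≡_mod_ : Carrier → Carrier → Carrier → Set
  x ≡ y mod m = ∃[ h ] x ≈ y + m * h

  sum : (ℕ → Carrier) → ℕ → Carrier
  sum f zero    = 0#
  sum f (suc n) = sum f n + f n

  sgn : ℕ → Carrier
  sgn n = (- 1#) ^ n

  sgn-suc : ∀ n → sgn (suc n) + sgn n ≈ 0#
  sgn-suc n = begin
    - 1# * sgn n + sgn n      ≈⟨ +-congˡ (*-identityˡ (sgn n)) ⟨
    - 1# * sgn n + 1# * sgn n ≈⟨ distribʳ (sgn n) (- 1#) 1# ⟨
    (- 1# + 1#) * sgn n       ≈⟨ *-congʳ (-‿inverseˡ 1#) ⟩
    0# * sgn n                ≈⟨ zeroˡ (sgn n) ⟩
    0#                        ∎

  ≈⇒≡-mod : ∀ {x y} m → x ≈ y → x ≡ y mod m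
  ≈⇒≡-mod {x} {y} m x≈y = 0# , (begin
    x            ≈⟨ x≈y ⟩
    y            ≈⟨ solve 2 (λ y m → y := y :+ m :* con 0) refl y m ⟩
    y + m * 0#   ∎)

  mod-trans : ∀ {x y z m} → x ≡ y mod m → y ≡ z mod m → x ≡ z mod m
  mod-trans {x} {y} {z} {m} (h , x≈) (k , y≈) = k + h , (begin
    x                    ≈⟨ x≈ ⟩
    y + m * h            ≈⟨ +-congʳ y≈ ⟩
    z + m * k + m * h    ≈⟨ solve 4 (λ z m k h → z :+ m :* k :+ m :* h := z :+ m :* (k :+ h)) refl z m k h ⟩
    z + m * (k + h)      ∎)

  *-congˡ-mod : ∀ {x y m} z → x ≡ y mod m → z * x ≡ z * y mod m
  *-congˡ-mod {x} {y} {m} z (h , x≈) = z * h , (begin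
    z * x             ≈⟨ *-congˡ x≈ ⟩
    z * (y + m * h)   ≈⟨ solve 4 (λ z y m h → z :* (y :+ m :* h) := z :* y :+ m :* (z :* h)) refl z y m h ⟩
    z * y + m * (z * h) ∎)

  +*⇒≡-mod : ∀ {x y m h} → x + m * h ≈ y → x ≡ y mod m
  +*⇒≡-mod {x} {y} {m} {h} x≈ = - h , (begin
    x                          ≈⟨ solve 2 (λ x m → x := x :+ m :* con 0) refl x m ⟩
    x + m * 0#                 ≈⟨ +-congˡ (*-congˡ (-‿inverseʳ h)) ⟨
    x + m * (h + - h)          ≈⟨ solve 4 (λ x m h k → x :+ m :* (h :+ k) := x :+ m :* h :+ m :* k) refl x m h (- h) ⟩
    x + m * h + m * - h        ≈⟨ +-congʳ x≈ ⟩
    y + m * - h                ∎)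

  x′+x*m≈x⇒≡-mod : ∀ {x′ x m} → x′ + x * m ≈ x → x′ ≡ x mod m
  x′+x*m≈x⇒≡-mod {x′} {x} {m} x≈ = +*⇒≡-mod (trans (+-congˡ (*-comm m x)) x≈)

  x′≈x*[1+m]⇒≡-mod : ∀ {x′ x m} → x′ ≈ x * (1# + m) → x′ ≡ x mod m
  x′≈x*[1+m]⇒≡-mod {x′} {x} {m} x′≈ = x , (begin
    x′             ≈⟨ x′≈ ⟩
    x * (1# + m)   ≈⟨ solve 2 (λ x m → x :* (con 1 :+ m) := x :+ m :* x) refl x m ⟩
    x + m * x      ∎)

  x*y*z≈y*[x*z] : ∀ x y z → x * y * z ≈ y * (x * z)
  x*y*z≈y*[x*z] = solve 3 (λ x y z → x :* y :* z := y :* (x :* z)) refl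

  sum-cong : ∀ {f g : ℕ → Carrier} → (∀ k → f k ≈ g k) → ∀ n → sum f n ≈ sum g n
  sum-cong f≈g zero    = refl
  sum-cong f≈g (suc n) = +-cong (sum-cong f≈g n) (f≈g n)

  x*[1-bⁿb]+x*bⁿ⁺¹≈x : ∀ x b n → x * (1# - b ^ n * b) + x * b ^ suc n ≈ x
  x*[1-bⁿb]+x*bⁿ⁺¹≈x x b n = begin
    x * (1# + - (y * b)) + x * (b * y)
      ≈⟨ solve 4 (λ x y z b → x :* (con 1 :+ z) :+ x :* (b :* y) := x :* (con 1 :+ (z :+ y :* b))) refl
           x y (- (y * b)) b ⟩
    x * (1# + (- (y * b) + y * b))
      ≈⟨ *-congˡ (+-congˡ (-‿inverseˡ (y * b))) ⟩
    x * (1# + 0#)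
      ≈⟨ solve 1 (λ x → x :* (con 1 :+ con 0) := x) refl x ⟩
    x ∎
    where
    y = b ^ n

  x*[1-bⁿ[-b]]≈x*[1+bⁿ⁺¹] : ∀ x b n → x * (1# - b ^ n * - b) ≈ x * (1# + b ^ suc n)
  x*[1-bⁿ[-b]]≈x*[1+bⁿ⁺¹] x b n = *-congˡ (+-congˡ (begin
    - (y * - b)  ≈⟨ -‿cong (-‿distribʳ-* y b) ⟨
    - - (y * b)  ≈⟨ -‿involutive (y * b) ⟩
    y * b        ≈⟨ *-comm y b ⟩
    b * y        ∎))
    where
    y = b ^ n

  ^-suc-^ : ∀ x m n → (x ^ suc m) ^ n ≈ x ^ n * (x ^ m) ^ n
  ^-suc-^ x m n = begin
    (x ^ suc m) ^ n          ≈⟨ ^-assocʳ x (suc m) n ⟩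
    x ^ (n ℕ.+ m ℕ.* n)      ≈⟨ ^-homo-* x n (m ℕ.* n) ⟩
    x ^ n * x ^ (m ℕ.* n)    ≈⟨ *-congˡ (^-assocʳ x m n) ⟨
    x ^ n * (x ^ m) ^ n      ∎

  [x^2]^n≈x^n*x^n : ∀ x n → (x ^ 2) ^ n ≈ x ^ n * x ^ n
  [x^2]^n≈x^n*x^n x n = trans (^-suc-^ x 1 n) (*-congˡ (^-congˡ n (*-identityʳ x)))

  -- (b²)ⁿ is bⁿ bⁿ. The weaker modulus suffices and puts results in base q² on the same scale as
  -- those in base q.
  mod-[b^2]^n : ∀ {x y} b n → x ≡ y mod ((b ^ 2) ^ n) → x ≡ y mod (b ^ n)
  mod-[b^2]^n {x} {y} b n (h , x≈) = b ^ n * h , (begin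
    x                             ≈⟨ x≈ ⟩
    y + (b ^ 2) ^ n * h           ≈⟨ +-congˡ (*-congʳ ([x^2]^n≈x^n*x^n b n)) ⟩
    y + b ^ n * b ^ n * h         ≈⟨ +-congˡ (*-assoc (b ^ n) (b ^ n) h) ⟩
    y + b ^ n * (b ^ n * h)       ∎)

  x*[b^2]^n≈b^n*[x*b^n] : ∀ x b n → x * (b ^ 2) ^ n ≈ b ^ n * (x * b ^ n)
  x*[b^2]^n≈b^n*[x*b^n] x b n =
    trans (*-congˡ ([x^2]^n≈x^n*x^n b n)) (x∙yz≈y∙xz x (b ^ n) (b ^ n))

  -- Reduces both Euler's sum and Shanks' sum to the term at 0, all later terms having the common
  -- factor `m`.
  sum≡head : ∀ {m} {f g : ℕ → Carrier} → (∀ k → f (suc k) ≈ m * g k) → ∀ n → sum f (suc n) ≡ f 0 mod m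
  sum≡head {m} {f} {g} f≈ zero    = ≈⇒≡-mod m (+-identityˡ (f 0))
  sum≡head {m} {f} {g} f≈ (suc n) with sum≡head {g = g} f≈ n
  ... | h , s≈ = h + g n , (begin
    sum f (suc n) + f (suc n)    ≈⟨ +-cong s≈ (f≈ n) ⟩
    f 0 + m * h + m * g n        ≈⟨ solve 4 (λ a m h g → a :+ m :* h :+ m :* g := a :+ m :* (h :+ g)) refl (f 0) m h (g n) ⟩
    f 0 + m * (h + g n)          ∎)

  module _
    (b : Carrier) (p m r : ℕ → Carrier)
    (p-zero : p 0 ≈ 1#) (p-suc : ∀ n → p (suc n) + p n * b ^ suc n ≈ p n)
    (m-zero : m 0 ≈ 1#) (m-suc : ∀ n → m (suc n) ≈ m n * (1# + b ^ suc n))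
    (r-zero : r 0 ≈ 1#) (r-suc : ∀ n → r (suc n) + r n * (b ^ 2) ^ suc n ≈ r n)
    where

    -- (b;b)ₙ (-b;b)ₙ = (b²;b²)ₙ, factor by factor
    p*m≈r : ∀ n → p n * m n ≈ r n
    p*m≈r zero    = trans (*-cong p-zero m-zero) (trans (*-identityˡ 1#) (sym r-zero))
    -- With y = bⁿ⁺¹ this is (1 - y)(1 + y) = 1 - y². Adding `r n` times y² to both sides keeps it
    -- free of subtraction.
    p*m≈r (suc n) = +-cancelʳ (r n * (b ^ 2) ^ suc n) _ _ (begin
      p′ * m (suc n) + r n * (b ^ 2) ^ suc n
        ≈⟨ +-cong (*-congˡ (m-suc n)) (*-cong (sym (p*m≈r n)) ([x^2]^n≈x^n*x^n b (suc n))) ⟩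
      p′ * (m n * (1# + y)) + p n * m n * (y * y)
        ≈⟨ solve 4 (λ p′ m y p → p′ :* (m :* (con 1 :+ y)) :+ p :* m :* (y :* y)
                               := p′ :* m :+ (p′ :+ p :* y) :* m :* y) refl p′ (m n) y (p n) ⟩
      p′ * m n + (p′ + p n * y) * m n * y
        ≈⟨ +-congˡ (*-congʳ (*-congʳ (p-suc n))) ⟩
      p′ * m n + p n * m n * y
        ≈⟨ solve 4 (λ p′ m y p → p′ :* m :+ p :* m :* y := (p′ :+ p :* y) :* m) refl p′ (m n) y (p n) ⟩
      (p′ + p n * y) * m n
        ≈⟨ *-congʳ (p-suc n) ⟩
      p n * m n
        ≈⟨ p*m≈r n ⟩
      r n
        ≈⟨ r-suc n ⟨
      r (suc n) + r n * (b ^ 2) ^ suc n ∎)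
      where
      p′ = p (suc n)
      y  = b ^ suc n

  -- pₙ = (b;b)ₙ and cₙ = 1/(b;b)ₙ.  Recurrences are stated without subtraction,
  -- so that their consequences are within reach of the semiring solver.
  module Pochhammer
    (b : Carrier) (p c : ℕ → Carrier)
    (p-zero : p 0 ≈ 1#)
    (p-suc  : ∀ n → p (suc n) + p n * b ^ suc n ≈ p n)
    (p*c    : ∀ n → p n * c n ≈ 1#)
    where

    -- Multiply `p-suc n` by `c n * c (suc n)`; each product of a `p` with its `c` becomes 1.
    c-suc : ∀ n → c n + b ^ suc n * c (suc n) ≈ c (suc n)
    c-suc n = begin
      c n + y * c′
        ≈⟨ solve 3 (λ c y c′ → c :+ y :* c′ := con 1 :* c :+ con 1 :* (y :* c′)) refl (c n) y c′ ⟩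
      1# * c n + 1# * (y * c′)
        ≈⟨ +-cong (*-congʳ (p*c (suc n))) (*-congʳ (p*c n)) ⟨
      p (suc n) * c′ * c n + p n * c n * (y * c′)
        ≈⟨ solve 5 (λ p′ c′ c p y → p′ :* c′ :* c :+ p :* c :* (y :* c′) := (p′ :+ p :* y) :* c :* c′) refl
             (p (suc n)) c′ (c n) (p n) y ⟩
      (p (suc n) + p n * y) * c n * c′
        ≈⟨ *-congʳ (*-congʳ (p-suc n)) ⟩
      p n * c n * c′
        ≈⟨ *-congʳ (p*c n) ⟩
      1# * c′
        ≈⟨ *-identityˡ c′ ⟩
      c′ ∎
      where
      y  = b ^ suc n
      c′ = c (suc n)

    c-zero : c 0 ≈ 1#
    c-zero = begin
      c 0        ≈⟨ *-identityˡ (c 0) ⟨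
      1# * c 0   ≈⟨ *-congʳ p-zero ⟨
      p 0 * c 0  ≈⟨ p*c 0 ⟩
      1#         ∎

    -- Euler's series for (-b;b)_∞.

    euler : ℕ → Carrier
    euler m = b ^ tri m * c m

    -- Consecutive triangular numbers differ by m + 1, which is the power of b in `c-suc`. This
    -- drives both the pairing of Euler's terms and the functional equation of G.
    euler-split : ∀ m → euler m + euler (suc m) ≈ b ^ tri m * c (suc m)
    euler-split m = begin
      b ^ tri m * c m + b ^ (tri m ℕ.+ suc m) * c (suc m)
        ≈⟨ +-congˡ (*-congʳ (^-homo-* b (tri m) (suc m))) ⟩
      b ^ tri m * c m + b ^ tri m * b ^ suc m * c (suc m)
        ≈⟨ solve 4 (λ t c y c′ → t :* c :+ t :* y :* c′ := t :* (c :+ y :* c′)) refl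
             (b ^ tri m) (c m) (b ^ suc m) (c (suc m)) ⟩
      b ^ tri m * (c m + b ^ suc m * c (suc m))
        ≈⟨ *-congˡ (c-suc m) ⟩
      b ^ tri m * c (suc m) ∎

    -- Solved for the new term, this is a factor bᵐ⁺¹/(1 - bᵐ⁺¹); keeping that term on both sides
    -- avoids the division.
    euler-suc : ∀ m → euler (suc m) ≈ b ^ suc m * (euler m + euler (suc m))
    euler-suc m = begin
      b ^ (tri m ℕ.+ suc m) * c (suc m)
        ≈⟨ *-congʳ (^-homo-* b (tri m) (suc m)) ⟩
      b ^ tri m * b ^ suc m * c (suc m)
        ≈⟨ solve 3 (λ t y c → t :* y :* c := y :* (t :* c)) refl (b ^ tri m) (b ^ suc m) (c (suc m)) ⟩
      b ^ suc m * (b ^ tri m * c (suc m))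
        ≈⟨ *-congˡ (euler-split m) ⟨
      b ^ suc m * (euler m + euler (suc m)) ∎

    euler-zero : euler 0 ≈ 1#
    euler-zero = trans (*-identityˡ (c 0)) c-zero

    -- The partial sums of G(bʲ).
    eulerSum : ℕ → ℕ → Carrier
    eulerSum j = sum (λ m → euler m * (b ^ j) ^ m)

    -- G(x) = (1 + bx) G(bx) at x = bʲ, with the error made by truncating.
    eulerSum-rec : ∀ j n →
      eulerSum j (suc n) + (b ^ suc j) ^ suc n * euler n
        ≈ (1# + b ^ suc j) * eulerSum (suc j) (suc n)
    eulerSum-rec j zero = solve 2
      (λ a y → con 0 :+ a :* con 1 :+ y :* con 1 :* a
             := (con 1 :+ y) :* (con 0 :+ a :* con 1)) refl (euler 0) (b ^ suc j)
    eulerSum-rec j (suc n) = begin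
      S + a′ * u + Y * v * a′
        ≈⟨ +-congʳ (+-congˡ (*-congʳ (euler-suc n))) ⟩
      S + y * (a + a′) * u + Y * v * a′
        ≈⟨ solve 7 (λ S y a a′ u Y v → S :+ y :* (a :+ a′) :* u :+ Y :* v :* a′
                                     := S :+ y :* u :* a :+ y :* u :* a′ :+ Y :* v :* a′) refl
             S y a a′ u Y v ⟩
      S + y * u * a + y * u * a′ + Y * v * a′
        -- Now `S + v * a` is the left side of the induction hypothesis, so the previous truncation
        -- error is absorbed.
        ≈⟨ +-congʳ (+-cong (+-congˡ (*-congʳ v≈)) (*-congʳ v≈)) ⟨
      S + v * a + v * a′ + Y * v * a′
        ≈⟨ +-congʳ (+-congʳ (eulerSum-rec j n)) ⟩
      (1# + Y) * S′ + v * a′ + Y * v * a′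
        ≈⟨ solve 4 (λ Y S′ v a′ → (con 1 :+ Y) :* S′ :+ v :* a′ :+ Y :* v :* a′
                                := (con 1 :+ Y) :* (S′ :+ a′ :* v)) refl Y S′ v a′ ⟩
      (1# + Y) * (S′ + a′ * v) ∎
      where
      S = eulerSum j (suc n)
      S′ = eulerSum (suc j) (suc n)
      a = euler n
      a′ = euler (suc n)
      u = (b ^ j) ^ suc n
      v = (b ^ suc j) ^ suc n
      y = b ^ suc n
      Y = b ^ suc j
      v≈ : v ≈ y * u
      v≈ = ^-suc-^ b j (suc n)

    -- A quantitative form of G(bʲ) → 1: every term after a₀ = 1 contains bʲ.
    eulerSum≡1 : ∀ j n → eulerSum j (suc n) ≡ 1# mod (b ^ j)
    eulerSum≡1 j n = mod-trans
      (sum≡head {g = λ k → euler (suc k) * (b ^ j) ^ k}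
        (λ k → x∙yz≈y∙xz (euler (suc k)) (b ^ j) ((b ^ j) ^ k)) n)
      (≈⇒≡-mod (b ^ j) (trans (*-identityʳ (euler 0)) euler-zero))

    module _ (m : ℕ → Carrier)
      (m-zero : m 0 ≈ 1#)
      (m-suc  : ∀ n → m (suc n) ≈ m n * (1# + b ^ suc n))
      where

      -- The truncation error of `eulerSum-rec` at each step contains (bʲ⁺¹)ⁿ⁺¹, a multiple of bⁿ⁺¹
      -- whatever j is, so one modulus serves all iterations.
      eulerSum-iterate : ∀ j n → eulerSum 0 (suc n) ≡ m j * eulerSum j (suc n) mod (b ^ suc n)
      eulerSum-iterate zero n = ≈⇒≡-mod (b ^ suc n) (sym (trans (*-congʳ m-zero) (*-identityˡ _)))
      eulerSum-iterate (suc j) n = mod-trans (eulerSum-iterate j n) (mod-trans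
        (*-congˡ-mod (m j) (+*⇒≡-mod (begin
          S + y * ((b ^ j) ^ suc n * euler n)
            ≈⟨ +-congˡ (*-assoc y ((b ^ j) ^ suc n) (euler n)) ⟨
          S + y * (b ^ j) ^ suc n * euler n
            ≈⟨ +-congˡ (*-congʳ (^-suc-^ b j (suc n))) ⟨
          S + (b ^ suc j) ^ suc n * euler n
            ≈⟨ eulerSum-rec j n ⟩
          (1# + b ^ suc j) * S′ ∎)))
        (≈⇒≡-mod y (begin
          m j * ((1# + b ^ suc j) * S′) ≈⟨ *-assoc _ _ _ ⟨
          m j * (1# + b ^ suc j) * S′   ≈⟨ *-congʳ (m-suc j) ⟨
          m (suc j) * S′                ∎)))
        where
        y  = b ^ suc n
        S  = eulerSum j (suc n)
        S′ = eulerSum (suc j) (suc n)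

      -- Iterating n + 1 times makes the modulus bʲ of `eulerSum≡1` match the truncation modulus
      -- bⁿ⁺¹.
      euler-mod : ∀ n → sum euler (suc n) ≡ m (suc n) mod (b ^ suc n)
      euler-mod n = mod-trans
        (≈⇒≡-mod y (sum-cong (λ k → sym (trans (*-congˡ (^-assocʳ b 0 k)) (*-identityʳ (euler k)))) (suc n)))
        (mod-trans (eulerSum-iterate (suc n) n) (mod-trans
          (*-congˡ-mod (m (suc n)) (eulerSum≡1 (suc n) n))
          (≈⇒≡-mod y (*-identityʳ (m (suc n))))))
        where
        y = b ^ suc n

    -- The terms b^(2n² - n)/(b;b)₂ₙ, where 2n² - n is the (2n - 1)-st triangular number.
    evenTerm : ℕ → Carrier
    -- At n = 0 the index 2n - 1 is negative; the exponent is 0.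
    evenTerm zero    = c 0
    evenTerm (suc n) = b ^ tri (suc (double n)) * c (suc (suc (double n)))

    -- By `euler-split` each term with n > 0 is the pair a₂ₙ₋₁ + a₂ₙ, so the first n + 1 terms cover
    -- a₀ to a₂ₙ.
    sum-evenTerm : ∀ n → sum evenTerm (suc n) ≈ sum euler (suc (double n))
    sum-evenTerm zero    = +-congˡ (sym (*-identityˡ (c 0)))
    sum-evenTerm (suc n) = begin
      sum evenTerm (suc n) + evenTerm (suc n)
        ≈⟨ +-cong (sum-evenTerm n) (sym (euler-split (suc (double n)))) ⟩
      sum euler (suc (double n)) + (euler (suc (double n)) + euler (suc (suc (double n))))
        ≈⟨ +-assoc _ _ _ ⟨
      sum euler (suc (double (suc n))) ∎

    -- Shanks' identity and the pentagonal number theorem.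

    signedEuler : ℕ → Carrier
    signedEuler k = sgn k * euler k

    -- A subtraction-free form of wₖ₊₁(1 - y) = -wₖ y with y = bᵏ⁺¹; the sign comes from `sgn-suc`.
    signedEuler-suc : ∀ k →
      signedEuler (suc k) + signedEuler k * b ^ suc k ≈ signedEuler (suc k) * b ^ suc k
    signedEuler-suc k = begin
      s′ * a′ + s * a * y
        ≈⟨ +-congʳ (*-congˡ (euler-suc k)) ⟩
      s′ * (y * (a + a′)) + s * a * y
        ≈⟨ solve 5 (λ s s′ a a′ y → s′ :* (y :* (a :+ a′)) :+ s :* a :* y
                                  := (s′ :+ s) :* (a :* y) :+ s′ :* a′ :* y) refl s s′ a a′ y ⟩
      (s′ + s) * (a * y) + s′ * a′ * y
        ≈⟨ +-congʳ (trans (*-congʳ (sgn-suc k)) (zeroˡ (a * y))) ⟩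
      0# + s′ * a′ * y
        ≈⟨ +-identityˡ _ ⟩
      s′ * a′ * y ∎
      where
      s = sgn k
      s′ = sgn (suc k)
      a = euler k
      a′ = euler (suc k)
      y = b ^ suc k

    -- The terms on the right of Shanks' identity.
    shanks : ℕ → ℕ → Carrier
    shanks n k = p n * signedEuler k * (b ^ n) ^ k

    -- With Rₖ the extra summand on the left, `shanks n k` minus `shanks (suc n) k` equals Rₖ -
    -- Rₖ₋₁, where R₋₁ = 0. `p-suc` handles the change of n, `signedEuler-suc` that of k.
    shanks-telescope : ∀ n k →
      sum (shanks (suc n)) (suc k) + p n * signedEuler k * (b ^ suc n) ^ suc k
        ≈ sum (shanks n) (suc k)
    shanks-telescope n zero = begin
      0# + p′ * w * 1# + p n * w * (z * 1#)
        ≈⟨ solve 4 (λ p′ p w z → con 0 :+ p′ :* w :* con 1 :+ p :* w :* (z :* con 1)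
                               := con 0 :+ (p′ :+ p :* z) :* w :* con 1) refl p′ (p n) w z ⟩
      0# + (p′ + p n * z) * w * 1#
        ≈⟨ +-congˡ (*-congʳ (*-congʳ (p-suc n))) ⟩
      0# + p n * w * 1# ∎
      where
      p′ = p (suc n)
      w  = signedEuler 0
      z  = b ^ suc n
    shanks-telescope n (suc k) = begin
      S′ + p′ * w′ * V + p n * w′ * (z * V)
        ≈⟨ solve 6 (λ S′ p′ p w′ z V → S′ :+ p′ :* w′ :* V :+ p :* w′ :* (z :* V)
                                     := S′ :+ (p′ :+ p :* z) :* w′ :* V) refl S′ p′ (p n) w′ z V ⟩
      S′ + (p′ + p n * z) * w′ * V
        ≈⟨ +-congˡ (*-cong (*-congʳ (p-suc n)) V≈) ⟩
      S′ + p n * w′ * (y * x)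
        ≈⟨ solve 5 (λ S′ p w′ y x → S′ :+ p :* w′ :* (y :* x) := S′ :+ p :* (w′ :* y) :* x) refl
             S′ (p n) w′ y x ⟩
      S′ + p n * (w′ * y) * x
        -- Trading `w′ * y` for `w′ + w * y` splits off `p n * w * V`, the remainder at k, which the
        -- induction hypothesis absorbs.
        ≈⟨ +-congˡ (*-congʳ (*-congˡ (signedEuler-suc k))) ⟨
      S′ + p n * (w′ + w * y) * x
        ≈⟨ solve 6 (λ S′ p w w′ y x → S′ :+ p :* (w′ :+ w :* y) :* x
                                    := S′ :+ p :* w :* (y :* x) :+ p :* w′ :* x) refl
             S′ (p n) w w′ y x ⟩
      S′ + p n * w * (y * x) + p n * w′ * x
        ≈⟨ +-congʳ (+-congˡ (*-congˡ V≈)) ⟨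
      S′ + p n * w * V + p n * w′ * x
        ≈⟨ +-congʳ (shanks-telescope n k) ⟩
      sum (shanks n) (suc k) + p n * w′ * x ∎
      where
      S′ = sum (shanks (suc n)) (suc k)
      p′ = p (suc n)
      w  = signedEuler k
      w′ = signedEuler (suc k)
      y  = b ^ suc k
      z  = b ^ suc n
      x  = (b ^ n) ^ suc k
      V  = (b ^ suc n) ^ suc k
      V≈ : V ≈ y * x
      V≈ = ^-suc-^ b n (suc k)

    pentTerm⁺ pentTerm⁻ : ℕ → Carrier
    pentTerm⁺ k = sgn k * b ^ pent⁺ k
    pentTerm⁻ k = sgn (suc k) * b ^ pent⁻ k

    -- On the diagonal `p n` cancels `c n`, leaving a monomial. The free `x` lets this serve both
    -- the last term of Shanks' sum and the telescoping remainder.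
    shanks-diagonal : ∀ n t x → b ^ t ≈ b ^ tri n * x → p n * signedEuler n * x ≈ sgn n * b ^ t
    shanks-diagonal n t x t≈ = begin
      p n * (sgn n * (b ^ tri n * c n)) * x
        ≈⟨ solve 5 (λ p s t c x → p :* (s :* (t :* c)) :* x := p :* c :* (s :* (t :* x))) refl
             (p n) (sgn n) (b ^ tri n) (c n) x ⟩
      p n * c n * (sgn n * (b ^ tri n * x))
        ≈⟨ *-cong (p*c n) (*-congˡ (sym t≈)) ⟩
      1# * (sgn n * b ^ t)
        ≈⟨ *-identityˡ _ ⟩
      sgn n * b ^ t ∎

    -- Passing to n + 1 adds two theta terms. The one of index -(n + 1) is the new diagonal term
    -- `T`; the one of index n + 1 cancels the telescoping remainder, which is the same monomial
    -- with the opposite sign.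
    shanks-identity : ∀ n → sum pentTerm⁻ n + sum pentTerm⁺ (suc n) ≈ sum (shanks n) (suc n)
    shanks-identity zero = begin
      0# + (0# + 1# * 1#)
        ≈⟨ solve 0 (con 0 :+ (con 0 :+ con 1 :* con 1) := con 0 :+ con 1 :* con 1 :* con 1) refl ⟩
      0# + 1# * 1# * 1#
        ≈⟨ +-congˡ (*-congʳ (*-cong p-zero (trans (*-identityˡ _) euler-zero))) ⟨
      0# + p 0 * signedEuler 0 * 1# ∎
    shanks-identity (suc n) = begin
      A + s′ * x + (B + s′ * y)
        ≈⟨ solve 4 (λ A x B y → A :+ x :+ (B :+ y) := A :+ B :+ x :+ y) refl A (s′ * x) B (s′ * y) ⟩
      A + B + s′ * x + s′ * y
        ≈⟨ +-congʳ (+-cong (shanks-identity n)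
             (sym (shanks-diagonal (suc n) (pent⁻ n) q² (pow (tri (suc n)))))) ⟩
      sum (shanks n) (suc n) + T + s′ * y
        ≈⟨ +-congʳ (+-congʳ (shanks-telescope n n)) ⟨
      S + p n * signedEuler n * q² + T + s′ * y
        ≈⟨ +-congʳ (+-congʳ (+-congˡ (shanks-diagonal n (pent⁺ (suc n)) q² (pow (tri n))))) ⟩
      S + s * y + T + s′ * y
        ≈⟨ solve 5 (λ S s s′ y T → S :+ s :* y :+ T :+ s′ :* y := S :+ T :+ (s′ :+ s) :* y) refl
             S s s′ y T ⟩
      S + T + (s′ + s) * y
        ≈⟨ +-congˡ (trans (*-congʳ (sgn-suc n)) (zeroˡ y)) ⟩
      S + T + 0#
        ≈⟨ +-identityʳ _ ⟩
      S + T ∎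
      where
      A  = sum pentTerm⁻ n
      B  = sum pentTerm⁺ (suc n)
      S  = sum (shanks (suc n)) (suc n)
      T  = shanks (suc n) (suc n)
      s  = sgn n
      s′ = sgn (suc n)
      x  = b ^ pent⁻ n
      y  = b ^ pent⁺ (suc n)
      -- This is b to the power (n + 1)², the factor common to both new pentagonal powers.
      q² = (b ^ suc n) ^ suc n
      pow : ∀ t → b ^ (t ℕ.+ suc n ℕ.* suc n) ≈ b ^ t * q²
      pow t = trans (^-homo-* b t (suc n ℕ.* suc n)) (*-congˡ (sym (^-assocʳ b (suc n) (suc n))))

    pentagonal-mod : ∀ n → sum pentTerm⁻ n + sum pentTerm⁺ (suc n) ≡ p n mod (b ^ n)
    pentagonal-mod n = mod-trans (≈⇒≡-mod (b ^ n) (shanks-identity n)) (mod-trans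
      (sum≡head {g = λ k → p n * signedEuler (suc k) * (b ^ n) ^ k}
        (λ k → x∙yz≈y∙xz (p n * signedEuler (suc k)) (b ^ n) ((b ^ n) ^ k)) n)
      (≈⇒≡-mod (b ^ n) (begin
        p n * (1# * euler 0) * 1#
          ≈⟨ solve 2 (λ p a → p :* (con 1 :* a) :* con 1 := p :* a) refl (p n) (euler 0) ⟩
        p n * euler 0
          ≈⟨ trans (*-congˡ euler-zero) (*-identityʳ (p n)) ⟩
        p n ∎)))


open import Defs
import Algebra.Construct.Pointwise as Pointwise
open import Data.Integer.Base as ℤ using (ℤ; 0ℤ; 1ℤ; +_; -[1+_]; ∣_∣)
import Data.Integer.Properties as ℤP
open import Data.Integer.Solver using (module +-*-Solver)
open import Relation.Binary.PropositionalEquality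
open +-*-Solver using (solve; _:=_; _:+_; _:*_; :-_) renaming (con to conᶻ)
open import Data.Nat.Solver renaming (module +-*-Solver to ℕ-Solver)
open ℕ-Solver using () renaming (solve to solveⁿ; _:=_ to _⊜_; _:+_ to _⊕_; _:*_ to _⊗_; con to conⁿ)
open ≡-Reasoning

-- The commutative ring of formal power series.

tail : FPS → FPS
tail f n = f (suc n)

_•_ : ℤ → FPS → FPS
(c • f) n = c ℤ.* f n

-- The definition of _*_ unfolds to
--   (f * g) (suc n) = f 0 ℤ.* g (suc n) ℤ.+ (tail f * g) n,
-- so the ring laws follow by induction on the degree.

*-cong : ∀ {f f′ g g′} → f ≗ f′ → g ≗ g′ → f * g ≗ f′ * g′
*-cong f≗f′ g≗g′ zero    = cong₂ (λ a b → a ℤ.* b ℤ.+ 0ℤ) (f≗f′ 0) (g≗g′ 0)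
*-cong f≗f′ g≗g′ (suc n) =
  cong₂ ℤ._+_ (cong₂ ℤ._*_ (f≗f′ 0) (g≗g′ (suc n)))
              (*-cong (λ m → f≗f′ (suc m)) g≗g′ n)

*-distribʳ-+ : ∀ h f g → (f + g) * h ≗ f * h + g * h
*-distribʳ-+ h f g zero = solve 3
  (λ a b c → (a :+ b) :* c :+ conᶻ 0ℤ := a :* c :+ conᶻ 0ℤ :+ (b :* c :+ conᶻ 0ℤ)) refl
  (f 0) (g 0) (h 0)
*-distribʳ-+ h f g (suc n) rewrite *-distribʳ-+ h (tail f) (tail g) n = solve 5
  (λ a b c x y → (a :+ b) :* c :+ (x :+ y) := a :* c :+ x :+ (b :* c :+ y)) refl
  (f 0) (g 0) (h (suc n)) ((tail f * h) n) ((tail g * h) n)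

•-*-assoc : ∀ c f g → (c • f) * g ≗ c • (f * g)
•-*-assoc c f g zero = solve 3
  (λ c a b → c :* a :* b :+ conᶻ 0ℤ := c :* (a :* b :+ conᶻ 0ℤ)) refl c (f 0) (g 0)
•-*-assoc c f g (suc n) rewrite •-*-assoc c (tail f) g n = solve 4
  (λ c a b x → c :* a :* b :+ c :* x := c :* (a :* b :+ x)) refl
  c (f 0) (g (suc n)) ((tail f * g) n)

-- The defining recursion shortens the left factor; this one shortens the right, which is what
-- `*-comm` needs for its induction.
*-sucʳ : ∀ f g n → (f * g) (suc n) ≡ f (suc n) ℤ.* g 0 ℤ.+ (f * tail g) n
*-sucʳ f g zero = solve 4
  (λ a b c d → a :* b :+ (c :* d :+ conᶻ 0ℤ) := c :* d :+ (a :* b :+ conᶻ 0ℤ)) refl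
  (f 0) (g 1) (f 1) (g 0)
*-sucʳ f g (suc n) rewrite *-sucʳ (tail f) g n = solve 3
  (λ a b c → a :+ (b :+ c) := b :+ (a :+ c)) refl
  (f 0 ℤ.* g (suc (suc n))) (f (suc (suc n)) ℤ.* g 0) ((tail f * tail g) n)

*-comm : ∀ f g → f * g ≗ g * f
*-comm f g zero    = cong (ℤ._+ 0ℤ) (ℤP.*-comm (f 0) (g 0))
*-comm f g (suc n) = begin
  f 0 ℤ.* g (suc n) ℤ.+ (tail f * g) n
    ≡⟨ cong₂ ℤ._+_ (ℤP.*-comm (f 0) (g (suc n))) (*-comm (tail f) g n) ⟩
  g (suc n) ℤ.* f 0 ℤ.+ (g * tail f) n
    ≡⟨ *-sucʳ g f n ⟨
  (g * f) (suc n) ∎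

*-assoc : ∀ f g h → (f * g) * h ≗ f * (g * h)
*-assoc f g h zero = solve 3
  (λ a b c → (a :* b :+ conᶻ 0ℤ) :* c :+ conᶻ 0ℤ := a :* (b :* c :+ conᶻ 0ℤ) :+ conᶻ 0ℤ) refl
  (f 0) (g 0) (h 0)
*-assoc f g h (suc n) = begin
  -- By unfolding, the tail of `f * g` is `f 0 • tail g + tail f * g`.
  (f 0 ℤ.* g 0 ℤ.+ 0ℤ) ℤ.* h (suc n) ℤ.+ ((f 0 • tail g + tail f * g) * h) n
    ≡⟨ cong (λ x → (f 0 ℤ.* g 0 ℤ.+ 0ℤ) ℤ.* h (suc n) ℤ.+ x) (begin
         ((f 0 • tail g + tail f * g) * h) n
           ≡⟨ *-distribʳ-+ h (f 0 • tail g) (tail f * g) n ⟩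
         ((f 0 • tail g) * h) n ℤ.+ ((tail f * g) * h) n
           ≡⟨ cong₂ ℤ._+_ (•-*-assoc (f 0) (tail g) h n) (*-assoc (tail f) g h n) ⟩
         f 0 ℤ.* (tail g * h) n ℤ.+ (tail f * (g * h)) n ∎) ⟩
  (f 0 ℤ.* g 0 ℤ.+ 0ℤ) ℤ.* h (suc n)
    ℤ.+ (f 0 ℤ.* (tail g * h) n ℤ.+ (tail f * (g * h)) n)
    ≡⟨ solve 5 (λ a b c x y → (a :* b :+ conᶻ 0ℤ) :* c :+ (a :* x :+ y)
                              := a :* (b :* c :+ x) :+ y) refl
         (f 0) (g 0) (h (suc n)) ((tail g * h) n) ((tail f * (g * h)) n) ⟩
  f 0 ℤ.* (g 0 ℤ.* h (suc n) ℤ.+ (tail g * h) n) ℤ.+ (tail f * (g * h)) n ∎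

*-zeroˡ : ∀ f → 0# * f ≗ 0#
*-zeroˡ f zero    = refl
*-zeroˡ f (suc n) = trans (ℤP.+-identityˡ _) (*-zeroˡ f n)

*-identityˡ : ∀ f → 1# * f ≗ f
*-identityˡ f zero    = trans (ℤP.+-identityʳ _) (ℤP.*-identityˡ (f 0))
*-identityˡ f (suc n) = begin
  1ℤ ℤ.* f (suc n) ℤ.+ (0# * f) n  ≡⟨ cong₂ ℤ._+_ (ℤP.*-identityˡ (f (suc n))) (*-zeroˡ f n) ⟩
  f (suc n) ℤ.+ 0ℤ                 ≡⟨ ℤP.+-identityʳ (f (suc n)) ⟩
  f (suc n)                        ∎

FPS-commutativeRing : CommutativeRing 0ℓ 0ℓ
FPS-commutativeRing = record
  { Carrier = FPS
  ; _≈_     = _≗_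
  ; _+_     = _+_
  ; _*_     = _*_
  ; -_      = -_
  ; 0#      = 0#
  ; 1#      = 1#
  ; isCommutativeRing = record
    { isRing = record
      { +-isAbelianGroup = Pointwise.isAbelianGroup ℕ ℤP.+-0-isAbelianGroup
      ; *-cong           = *-cong
      ; *-assoc          = *-assoc
      ; *-identity       = *-identityˡ , λ f n → trans (*-comm f 1# n) (*-identityˡ f n)
      ; distrib          = (λ f g h n → begin
          (f * (g + h)) n              ≡⟨ *-comm f (g + h) n ⟩
          ((g + h) * f) n              ≡⟨ *-distribʳ-+ f g h n ⟩
          (g * f) n ℤ.+ (h * f) n      ≡⟨ cong₂ ℤ._+_ (*-comm g f n) (*-comm h f n) ⟩
          (f * g) n ℤ.+ (f * h) n      ∎) , *-distribʳ-+
      }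
    ; *-comm = *-comm
    }
  }

open QSeries FPS-commutativeRing
module FPS-ring = CommutativeRing FPS-commutativeRing
open Exp FPS-ring.semiring using (^-assocʳ) renaming (_^_ to _^ʳ_)

-- Both powers have the same recursion, so they agree propositionally and not just up to `_≗_`;
-- `rewrite` relies on this.
^≡^ʳ : ∀ f n → f ^ n ≡ f ^ʳ n
^≡^ʳ f zero    = refl
^≡^ʳ f (suc n) = cong (f *_) (^≡^ʳ f n)

-- From congruences modulo powers of q to coefficients and limits.

partialSum≗sum : ∀ {f g} → (∀ k → f k ≗ g k) → ∀ n → partialSum f n ≗ sum g n
partialSum≗sum f≗g zero    m = refl
partialSum≗sum f≗g (suc n) m = cong₂ ℤ._+_ (partialSum≗sum f≗g n m) (f≗g n m)

partialSum-stable : ∀ {f m N} → (∀ k → N ℕ.≤ k → f k m ≡ 0ℤ) →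
                    ∀ {n} → N ℕ.≤ n → partialSum f n m ≡ partialSum f N m
partialSum-stable {f} {m} {N} f≡0 N≤n = go (ℕP.≤⇒≤′ N≤n)
  where
  go : ∀ {n} → N ℕ.≤′ n → partialSum f n m ≡ partialSum f N m
  go ℕ.≤′-refl               = refl
  go {suc n} (ℕ.≤′-step N≤n) = begin
    partialSum f n m ℤ.+ f n m ≡⟨ cong₂ ℤ._+_ (go N≤n) (f≡0 n (ℕP.≤′⇒≤ N≤n)) ⟩
    partialSum f N m ℤ.+ 0ℤ    ≡⟨ ℤP.+-identityʳ (partialSum f N m) ⟩
    partialSum f N m           ∎

-- Continuity of the product: it allows limits to be replaced by finite approximations inside one
-- coefficient.
*-cong-≤ : ∀ {f f′ g g′} n → (∀ {m} → m ℕ.≤ n → f m ≡ f′ m) → (∀ {m} → m ℕ.≤ n → g m ≡ g′ m) →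
           (f * g) n ≡ (f′ * g′) n
*-cong-≤ zero f≡f′ g≡g′ = cong₂ (λ a b → a ℤ.* b ℤ.+ 0ℤ) (f≡f′ ℕ.z≤n) (g≡g′ ℕ.z≤n)
*-cong-≤ (suc n) f≡f′ g≡g′ =
  cong₂ ℤ._+_ (cong₂ ℤ._*_ (f≡f′ ℕ.z≤n) (g≡g′ ℕP.≤-refl))
              (*-cong-≤ n (λ m≤n → f≡f′ (ℕ.s≤s m≤n)) (λ m≤n → g≡g′ (ℕP.m≤n⇒m≤1+n m≤n)))

q*f-suc : ∀ f n → (q * f) (suc n) ≡ f n
q*f-suc f n = begin
  0ℤ ℤ.+ (tail q * f) n  ≡⟨ ℤP.+-identityˡ ((tail q * f) n) ⟩
  (tail q * f) n         ≡⟨ *-cong {g = f} tail-q (λ _ → refl) n ⟩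
  (1# * f) n             ≡⟨ *-identityˡ f n ⟩
  f n                    ∎
  where
  tail-q : tail q ≗ 1#
  tail-q zero    = refl
  tail-q (suc _) = refl

coeff-q^n* : ∀ {m n} f → m ℕ.< n → (q ^ʳ n * f) m ≡ 0ℤ
coeff-q^n* {zero}  {suc n} f _ = *-assoc q (q ^ʳ n) f 0
coeff-q^n* {suc m} {suc n} f (ℕ.s≤s m<n) = begin
  (q * q ^ʳ n * f) (suc m)    ≡⟨ *-assoc q (q ^ʳ n) f (suc m) ⟩
  (q * (q ^ʳ n * f)) (suc m)  ≡⟨ q*f-suc (q ^ʳ n * f) m ⟩
  (q ^ʳ n * f) m              ≡⟨ coeff-q^n* f m<n ⟩
  0ℤ                          ∎

-- A multiple of qⁿ has no coefficients below degree n; this turns the ring-theoretic congruences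
-- into statements on coefficients.
coeff-≡-mod : ∀ {f g m n} → f ≡ g mod (q ^ʳ n) → m ℕ.< n → f m ≡ g m
coeff-≡-mod {f} {g} {m} {n} (h , f≗) m<n = begin
  f m                       ≡⟨ f≗ m ⟩
  g m ℤ.+ (q ^ʳ n * h) m    ≡⟨ cong (λ x → g m ℤ.+ x) (coeff-q^n* h m<n) ⟩
  g m ℤ.+ 0ℤ                ≡⟨ ℤP.+-identityʳ (g m) ⟩
  g m                       ∎

-- The diagonal is the limit when the n-th member is already final in degrees up to n, as `cauchy`
-- below ensures.
lim : (ℕ → FPS) → FPS
lim s m = s m m

module _ (s : ℕ → FPS) (cauchy : ∀ n → s (suc n) ≡ s n mod (q ^ʳ suc n)) where

  coeff-lim : ∀ {m n} → m ℕ.≤ n → s n m ≡ lim s m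
  coeff-lim {m} m≤n = go (ℕP.≤⇒≤′ m≤n)
    where
    go : ∀ {n} → m ℕ.≤′ n → s n m ≡ lim s m
    go ℕ.≤′-refl               = refl
    go {suc n} (ℕ.≤′-step m≤n) =
      trans (coeff-≡-mod {s (suc n)} {s n} (cauchy n) (ℕ.s≤s (ℕP.≤′⇒≤ m≤n))) (go m≤n)

  ⟶-lim : s ⟶ lim s
  ⟶-lim m = m , λ n → coeff-lim

⟨b⨾b⟩-suc : ∀ b n → ⟨ b ⨾ b ⟩ suc n + ⟨ b ⨾ b ⟩ n * b ^ʳ suc n ≗ ⟨ b ⨾ b ⟩ n
⟨b⨾b⟩-suc b n rewrite ^≡^ʳ b n = x*[1-bⁿb]+x*bⁿ⁺¹≈x (⟨ b ⨾ b ⟩ n) b n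

⟨-b⨾b⟩-suc : ∀ b n → ⟨ - b ⨾ b ⟩ suc n ≗ ⟨ - b ⨾ b ⟩ n * (1# + b ^ʳ suc n)
⟨-b⨾b⟩-suc b n rewrite ^≡^ʳ b n = x*[1-bⁿ[-b]]≈x*[1+bⁿ⁺¹] (⟨ - b ⨾ b ⟩ n) b n

⟨b⨾b⟩-cauchy : ∀ b n → ⟨ b ⨾ b ⟩ suc n ≡ ⟨ b ⨾ b ⟩ n mod (b ^ʳ suc n)
⟨b⨾b⟩-cauchy b n = x′+x*m≈x⇒≡-mod {⟨ b ⨾ b ⟩ suc n} {⟨ b ⨾ b ⟩ n} {b ^ʳ suc n} (⟨b⨾b⟩-suc b n)

⟨-b⨾b⟩-cauchy : ∀ b n → ⟨ - b ⨾ b ⟩ suc n ≡ ⟨ - b ⨾ b ⟩ n mod (b ^ʳ suc n)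
⟨-b⨾b⟩-cauchy b n =
  x′≈x*[1+m]⇒≡-mod {⟨ - b ⨾ b ⟩ suc n} {⟨ - b ⨾ b ⟩ n} {b ^ʳ suc n} (⟨-b⨾b⟩-suc b n)

-- The three infinite products.

p p₂ p₋ c c₂ : ℕ → FPS
p  = ⟨ q ⨾ q ⟩_
p₂ = ⟨ q ^ 2 ⨾ q ^ 2 ⟩_
p₋ = ⟨ - q ⨾ q ⟩_
c n  = inv (p n)
c₂ n = inv (p₂ n)

p₂-cauchy : ∀ n → p₂ (suc n) ≡ p₂ n mod (q ^ʳ suc n)
p₂-cauchy n = mod-[b^2]^n {p₂ (suc n)} {p₂ n} q (suc n) (⟨b⨾b⟩-cauchy (q ^ 2) n)

P P₂ P₋ : FPS
P  = lim p
P₂ = lim p₂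
P₋ = lim p₋

*-inv-1 : ∀ f → f 0 ≡ 1ℤ → f * inv f ≗ 1#
*-inv-1 f f₀≡1 = *-inv f (cong (λ x → x ℤ.* x) f₀≡1)

p*c≗1 : ∀ n → p n * c n ≗ 1#
p*c≗1 n = *-inv-1 (p n) (⟨q⨾q⟩-const n)

p₂*c₂≗1 : ∀ n → p₂ n * c₂ n ≗ 1#
-- The constant term is that of the limit, and `lim p₂ 0` computes to 1.
p₂*c₂≗1 n = *-inv-1 (p₂ n) (coeff-lim p₂ p₂-cauchy {n = n} ℕ.z≤n)

-- `E` supplies Euler's series in base q, `S` the pentagonal theorem in base q².
module E = Pochhammer q p c FPS-ring.refl (⟨b⨾b⟩-suc q) p*c≗1
module S = Pochhammer (q ^ 2) p₂ c₂ FPS-ring.refl (⟨b⨾b⟩-suc (q ^ 2)) p₂*c₂≗1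

-- In degree m all three limits may be replaced by their m-th members, for which `p*m≈r` holds.
P*P₋≗P₂ : P * P₋ ≗ P₂
P*P₋≗P₂ m = begin
  (P * P₋) m        ≡⟨ *-cong-≤ {P} {p m} {P₋} {p₋ m} m
                         (λ k≤m → sym (coeff-lim p (⟨b⨾b⟩-cauchy q) k≤m))
                         (λ k≤m → sym (coeff-lim p₋ (⟨-b⨾b⟩-cauchy q) k≤m)) ⟩
  (p m * p₋ m) m    ≡⟨ p*m≈r q p p₋ p₂ FPS-ring.refl (⟨b⨾b⟩-suc q) FPS-ring.refl (⟨-b⨾b⟩-suc q)
                         FPS-ring.refl (⟨b⨾b⟩-suc (q ^ 2)) m m ⟩
  p₂ m m            ∎

P₂/P≗P₋ : P₂ / P ≗ P₋
P₂/P≗P₋ m = begin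
  (P₂ * inv P) m         ≡⟨ *-cong {g = inv P} P*P₋≗P₂ (λ _ → refl) m ⟨
  (P * P₋ * inv P) m     ≡⟨ x*y*z≈y*[x*z] P P₋ (inv P) m ⟩
  (P₋ * (P * inv P)) m   ≡⟨ *-cong {P₋} (λ _ → refl) (*-inv-1 P refl) m ⟩
  (P₋ * 1#) m            ≡⟨ FPS-ring.*-identityʳ P₋ m ⟩
  P₋ m                   ∎

1/P*P₂≗P₂/P : 1# / P * P₂ ≗ P₂ / P
1/P*P₂≗P₂/P m = begin
  (1# * inv P * P₂) m   ≡⟨ *-cong {g = P₂} (*-identityˡ (inv P)) (λ _ → refl) m ⟩
  (inv P * P₂) m        ≡⟨ *-comm (inv P) P₂ m ⟩
  (P₂ * inv P) m        ∎

-- Arithmetic of the exponents.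

double≡2* : ∀ n → double n ≡ 2 ℕ.* n
double≡2* zero    = refl
double≡2* (suc n) = cong suc (trans (cong suc (double≡2* n)) (sym (ℕP.+-suc n (n ℕ.+ 0))))

n≤double : ∀ n → n ℕ.≤ double n
n≤double zero    = ℕ.z≤n
n≤double (suc n) = ℕ.s≤s (ℕP.m≤n⇒m≤1+n (n≤double n))

2*tri : ∀ n → 2 ℕ.* tri n ≡ n ℕ.* suc n
2*tri zero    = refl
2*tri (suc n) = begin
  2 ℕ.* (tri n ℕ.+ suc n)       ≡⟨ ℕP.*-distribˡ-+ 2 (tri n) (suc n) ⟩
  2 ℕ.* tri n ℕ.+ 2 ℕ.* suc n   ≡⟨ cong (ℕ._+ 2 ℕ.* suc n) (2*tri n) ⟩
  n ℕ.* suc n ℕ.+ 2 ℕ.* suc n   ≡⟨ solveⁿ 1 (λ n → n ⊗ (conⁿ 1 ⊕ n) ⊕ conⁿ 2 ⊗ (conⁿ 1 ⊕ n) ⊜ (conⁿ 1 ⊕ n) ⊗ (conⁿ 2 ⊕ n)) refl n ⟩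
  suc n ℕ.* suc (suc n)         ∎

-- Adding `suc n` removes the truncated subtraction and doubling clears the half in `tri`; what
-- remains is a polynomial identity.
2n²-n≡tri : ∀ n → 2n²-n (suc n) ≡ tri (suc (double n))
2n²-n≡tri n = ℕP.+-cancelʳ-≡ (suc n) _ _ (ℕP.*-cancelˡ-≡ _ _ 2 (begin
  2 ℕ.* (2n²-n (suc n) ℕ.+ suc n)
    ≡⟨ cong (2 ℕ.*_) (2n²-n-exact (suc n)) ⟩
  2 ℕ.* (2 ℕ.* (suc n ℕ.* (suc n ℕ.* 1)))
    ≡⟨ solveⁿ 1 (λ n → conⁿ 2 ⊗ (conⁿ 2 ⊗ ((conⁿ 1 ⊕ n) ⊗ ((conⁿ 1 ⊕ n) ⊗ conⁿ 1)))
                      ⊜ (conⁿ 1 ⊕ conⁿ 2 ⊗ n) ⊗ (conⁿ 2 ⊕ conⁿ 2 ⊗ n) ⊕ conⁿ 2 ⊗ (conⁿ 1 ⊕ n)) refl n ⟩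
  suc (2 ℕ.* n) ℕ.* suc (suc (2 ℕ.* n)) ℕ.+ 2 ℕ.* suc n
    ≡⟨ cong (λ d → suc d ℕ.* suc (suc d) ℕ.+ 2 ℕ.* suc n) (double≡2* n) ⟨
  suc (double n) ℕ.* suc (suc (double n)) ℕ.+ 2 ℕ.* suc n
    ≡⟨ cong (ℕ._+ 2 ℕ.* suc n) (2*tri (suc (double n))) ⟨
  2 ℕ.* tri (suc (double n)) ℕ.+ 2 ℕ.* suc n
    ≡⟨ ℕP.*-distribˡ-+ 2 (tri (suc (double n))) (suc n) ⟨
  2 ℕ.* (tri (suc (double n)) ℕ.+ suc n) ∎))

2*pent⁺ : ∀ n → 2 ℕ.* pent⁺ n ℕ.+ n ≡ 3 ℕ.* (n ℕ.* n)
2*pent⁺ zero    = refl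
2*pent⁺ (suc n) = begin
  2 ℕ.* (tri n ℕ.+ suc n ℕ.* suc n) ℕ.+ suc n
    ≡⟨ solveⁿ 2 (λ t n → conⁿ 2 ⊗ (t ⊕ (conⁿ 1 ⊕ n) ⊗ (conⁿ 1 ⊕ n)) ⊕ (conⁿ 1 ⊕ n)
                   ⊜ conⁿ 2 ⊗ t ⊕ (conⁿ 2 ⊗ ((conⁿ 1 ⊕ n) ⊗ (conⁿ 1 ⊕ n)) ⊕ (conⁿ 1 ⊕ n))) refl (tri n) n ⟩
  2 ℕ.* tri n ℕ.+ (2 ℕ.* (suc n ℕ.* suc n) ℕ.+ suc n)
    ≡⟨ cong (ℕ._+ (2 ℕ.* (suc n ℕ.* suc n) ℕ.+ suc n)) (2*tri n) ⟩
  n ℕ.* suc n ℕ.+ (2 ℕ.* (suc n ℕ.* suc n) ℕ.+ suc n)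
    ≡⟨ solveⁿ 1 (λ n → n ⊗ (conⁿ 1 ⊕ n) ⊕ (conⁿ 2 ⊗ ((conⁿ 1 ⊕ n) ⊗ (conⁿ 1 ⊕ n)) ⊕ (conⁿ 1 ⊕ n))
                      ⊜ conⁿ 3 ⊗ ((conⁿ 1 ⊕ n) ⊗ (conⁿ 1 ⊕ n))) refl n ⟩
  3 ℕ.* (suc n ℕ.* suc n) ∎

2*pent⁻ : ∀ n → 2 ℕ.* pent⁻ n ≡ 3 ℕ.* (suc n ℕ.* suc n) ℕ.+ suc n
2*pent⁻ n = begin
  2 ℕ.* (tri (suc n) ℕ.+ suc n ℕ.* suc n)
    ≡⟨ ℕP.*-distribˡ-+ 2 (tri (suc n)) (suc n ℕ.* suc n) ⟩
  2 ℕ.* tri (suc n) ℕ.+ 2 ℕ.* (suc n ℕ.* suc n)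
    ≡⟨ cong (ℕ._+ 2 ℕ.* (suc n ℕ.* suc n)) (2*tri (suc n)) ⟩
  suc n ℕ.* suc (suc n) ℕ.+ 2 ℕ.* (suc n ℕ.* suc n)
    ≡⟨ solveⁿ 1 (λ n → (conⁿ 1 ⊕ n) ⊗ (conⁿ 2 ⊕ n) ⊕ conⁿ 2 ⊗ ((conⁿ 1 ⊕ n) ⊗ (conⁿ 1 ⊕ n))
                      ⊜ conⁿ 3 ⊗ ((conⁿ 1 ⊕ n) ⊗ (conⁿ 1 ⊕ n)) ⊕ (conⁿ 1 ⊕ n)) refl n ⟩
  3 ℕ.* (suc n ℕ.* suc n) ℕ.+ suc n ∎

pos-3*² : ∀ n → + (3 ℕ.* (n ℕ.* n)) ≡ + 3 ℤ.* (+ n ℤ.* + n)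
pos-3*² n = trans (ℤP.pos-* 3 (n ℕ.* n)) (cong (+ 3 ℤ.*_) (ℤP.pos-* n n))

-- The theta exponent is twice a pentagonal number, hence the base q².
3k²-k-+ : ∀ n → 3k²-k (+ n) ≡ 2 ℕ.* pent⁺ n
3k²-k-+ n = ℤP.+-injective (begin
  + 3k²-k (+ n)
    ≡⟨ 3k²-k-exact (+ n) ⟩
  + 3 ℤ.* (+ n ℤ.* (+ n ℤ.* 1ℤ)) ℤ.- + n
    ≡⟨ cong (λ x → + 3 ℤ.* (+ n ℤ.* x) ℤ.- + n) (ℤP.*-identityʳ (+ n)) ⟩
  + 3 ℤ.* (+ n ℤ.* + n) ℤ.- + n
    ≡⟨ cong (ℤ._- + n) (pos-3*² n) ⟨
  + (3 ℕ.* (n ℕ.* n)) ℤ.- + n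
    ≡⟨ cong (λ x → + x ℤ.- + n) (2*pent⁺ n) ⟨
  + (2 ℕ.* pent⁺ n) ℤ.+ + n ℤ.- + n
    ≡⟨ solve 2 (λ a b → a :+ b :+ :- b := a) refl (+ (2 ℕ.* pent⁺ n)) (+ n) ⟩
  + (2 ℕ.* pent⁺ n) ∎)

3k²-k-− : ∀ n → 3k²-k -[1+ n ] ≡ 2 ℕ.* pent⁻ n
3k²-k-− n = ℤP.+-injective (begin
  + 3k²-k -[1+ n ]
    ≡⟨ 3k²-k-exact -[1+ n ] ⟩
  + 3 ℤ.* (ℤ.- + suc n ℤ.* (ℤ.- + suc n ℤ.* 1ℤ)) ℤ.- (ℤ.- + suc n)
    ≡⟨ solve 1 (λ x → conᶻ (+ 3) :* (:- x :* (:- x :* conᶻ 1ℤ)) :+ :- (:- x) := conᶻ (+ 3) :* (x :* x) :+ x) refl (+ suc n) ⟩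
  + 3 ℤ.* (+ suc n ℤ.* + suc n) ℤ.+ + suc n
    ≡⟨ cong (ℤ._+ + suc n) (pos-3*² (suc n)) ⟨
  + (3 ℕ.* (suc n ℕ.* suc n) ℕ.+ suc n)
    ≡⟨ cong +_ (2*pent⁻ n) ⟨
  + (2 ℕ.* pent⁻ n) ∎)

-- Convergence of the two series.

term≗evenTerm : ∀ n → q ^ 2n²-n n / p (2 ℕ.* n) ≗ E.evenTerm n
term≗evenTerm zero = *-identityˡ (c 0)
term≗evenTerm (suc n) m = cong (λ f → f m) (cong₂ (λ f k → f * c k)
  (trans (^≡^ʳ q (2n²-n (suc n))) (cong (q ^ʳ_) (2n²-n≡tri n)))
  (sym (double≡2* (suc n))))

signed-power : ∀ k {e} t → e ≡ 2 ℕ.* t → (- 1#) ^ k * q ^ e ≗ sgn k * (q ^ 2) ^ʳ t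
signed-power k t refl m rewrite ^≡^ʳ (- 1#) k | ^≡^ʳ q (2 ℕ.* t) =
  *-cong {sgn k} (λ _ → refl) (FPS-ring.sym (^-assocʳ q 2 t)) m

signed-power-low : ∀ {m t} f → m ℕ.< t → (f * (q ^ 2) ^ʳ t) m ≡ 0ℤ
signed-power-low {m} {t} f m<t = trans (x*[b^2]^n≈b^n*[x*b^n] f q t m) (coeff-q^n* (f * q ^ʳ t) m<t)

n≤pent⁺ : ∀ n → n ℕ.≤ pent⁺ n
n≤pent⁺ zero    = ℕ.z≤n
n≤pent⁺ (suc n) = ℕP.≤-trans (ℕP.m≤m*n (suc n) (suc n)) (ℕP.m≤n+m _ (tri n))

n<pent⁻ : ∀ n → n ℕ.< pent⁻ n
n<pent⁻ n = ℕP.≤-trans (ℕP.m≤m*n (suc n) (suc n)) (ℕP.m≤n+m _ (tri (suc n)))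

∑ℕ-terms : ∑ℕ (λ n → q ^ 2n²-n n / p (2 ℕ.* n)) ≈ P₋
-- n + 1 terms amount to 2n + 1 Euler terms, exact in degrees up to 2n. The bound `suc m` rules out
-- the empty sum and gives m ≤ n ≤ 2n.
∑ℕ-terms m = suc m , λ { (suc n) (ℕ.s≤s m≤n) →
  let m≤2n = ℕP.≤-trans m≤n (n≤double n) in begin
  partialSum (λ n → q ^ 2n²-n n / p (2 ℕ.* n)) (suc n) m
    ≡⟨ partialSum≗sum term≗evenTerm (suc n) m ⟩
  sum E.evenTerm (suc n) m
    ≡⟨ E.sum-evenTerm n m ⟩
  sum E.euler (suc (double n)) m
    ≡⟨ coeff-≡-mod {g = p₋ (suc (double n))}
         (E.euler-mod p₋ FPS-ring.refl (⟨-b⨾b⟩-suc q) (double n)) (ℕ.s≤s m≤2n) ⟩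
  p₋ (suc (double n)) m
    ≡⟨ coeff-lim p₋ (⟨-b⨾b⟩-cauchy q) (ℕP.m≤n⇒m≤1+n m≤2n) ⟩
  P₋ m ∎ }

∑ℤ-terms : ∑ℤ (λ k → (- 1#) ^ ∣ k ∣ * q ^ 3k²-k k) ≈ P₂
∑ℤ-terms m = N , λ a b N≤a N≤b → begin
  partialSum (λ n → f -[1+ n ]) a m ℤ.+ partialSum (λ n → f (+ n)) b m
    -- Both ends are moved to Shanks' range -N ≤ k ≤ N, which has N negative indices and N + 1
    -- others.
    ≡⟨ cong₂ ℤ._+_ (partialSum-stable f⁻-low N≤a)
         (trans (partialSum-stable f⁺-low N≤b) (sym (partialSum-stable f⁺-low (ℕP.n≤1+n N)))) ⟩
  partialSum (λ n → f -[1+ n ]) N m ℤ.+ partialSum (λ n → f (+ n)) (suc N) m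
    ≡⟨ cong₂ ℤ._+_ (partialSum≗sum f⁻≗ N m) (partialSum≗sum f⁺≗ (suc N) m) ⟩
  (sum S.pentTerm⁻ N + sum S.pentTerm⁺ (suc N)) m
    ≡⟨ coeff-≡-mod {g = p₂ N}
         (mod-[b^2]^n {sum S.pentTerm⁻ N + sum S.pentTerm⁺ (suc N)} {p₂ N} q N (S.pentagonal-mod N))
         ℕP.≤-refl ⟩
  p₂ N m
    ≡⟨ coeff-lim p₂ p₂-cauchy (ℕP.n≤1+n m) ⟩
  P₂ m ∎
  where
  -- Large enough that degree m lies below q^N, the modulus of `pentagonal-mod` once reduced to base
  -- q, and below every term outside the range.
  N = suc m
  f : ℤ → FPS
  f k = (- 1#) ^ ∣ k ∣ * q ^ 3k²-k k
  f⁺≗ : ∀ n → f (+ n) ≗ S.pentTerm⁺ n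
  f⁺≗ n = signed-power n (pent⁺ n) (3k²-k-+ n)
  f⁻≗ : ∀ n → f -[1+ n ] ≗ S.pentTerm⁻ n
  f⁻≗ n = signed-power (suc n) (pent⁻ n) (3k²-k-− n)
  f⁺-low : ∀ n → N ℕ.≤ n → f (+ n) m ≡ 0ℤ
  f⁺-low n N≤n = trans (f⁺≗ n m) (signed-power-low (sgn n) (ℕP.≤-trans N≤n (n≤pent⁺ n)))
  f⁻-low : ∀ n → N ℕ.≤ n → f -[1+ n ] m ≡ 0ℤ
  f⁻-low n N≤n = trans (f⁻≗ n m)
    (signed-power-low (sgn (suc n)) (ℕP.≤-trans N≤n (ℕP.<⇒≤ (n<pent⁻ n))))

corollary5p7 : ∃[ S ] ∃[ T ] ∃[ P ] ∃[ P₂ ] ∃[ P₋ ]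
    ( ∑ℕ (λ n → q ^ 2n²-n n / ⟨ q ⨾ q ⟩ (2 ℕ.* n)) ≈ S
    × ∑ℤ (λ k → (- 1#) ^ ∣ k ∣ * q ^ 3k²-k k) ≈ T
    × ⟨ q ⨾ q ⟩∞≈ P
    × ⟨ q ^ 2 ⨾ q ^ 2 ⟩∞≈ P₂
    × ⟨ - q ⨾ q ⟩∞≈ P₋
    × S ≗ 1# / P * T
    × 1# / P * T ≗ P₂ / P
    × P₂ / P ≗ P₋ )
corollary5p7 =
  -- Each sum is witnessed by the product it converges to, so the first equation follows from the
  -- other two.
  P₋ , P₂ , P , P₂ , P₋ ,
  ∑ℕ-terms ,
  ∑ℤ-terms ,
  ⟶-lim p (⟨b⨾b⟩-cauchy q) ,
  ⟶-lim p₂ p₂-cauchy ,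
  ⟶-lim p₋ (⟨-b⨾b⟩-cauchy q) ,
  (λ m → sym (trans (1/P*P₂≗P₂/P m) (P₂/P≗P₋ m))) ,
  1/P*P₂≗P₂/P ,
  P₂/P≗P₋
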